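{- For a word $u$ of length $n$, its left-seed array $\mathsf{LSeed}[1..n]$, where $\mathsf{LSeed}[i]=\mathrm{lseed}(u[1..i])$, can be computed in $O(n)$ time.
   Context: Words are over a finite alphabet; $u[1..i]$ is the prefix of length $i$. A word $s$ covers $w$ if every position of $w$ lies in some occurrence of $s$ in $w$. A seed of a word $x$ is a factor $s$ of $x$ such that $x$ is a factor of some word covered by $s$; a left seed of $x$ is a seed of $x$ which is a prefix of $x$; $\mathrm{lseed}(x)$ is the length of the shortest left seed of $x$. -}

module Defs where

open import Data.Bool using (Bool; true; false; if_then_else_)
open import Data.Fin using (Fin; toℕ)
open import Data.List using (List; []; _∷_; length; drop)
open import Data.List.Relation.Binary.Infix.Heterogeneous using (Infix)
open import Data.List.Relation.Binary.Prefix.Heterogeneous using (Prefix)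
open import Data.Nat using (ℕ; zero; suc; _+_; _*_; _∸_; _^_; _≤_; _<_; _≡ᵇ_; _<ᵇ_; _≤ᵇ_)
open import Data.Product using (_×_; ∃-syntax)
open import Relation.Binary.PropositionalEquality using (_≡_)

Word : ℕ → Set
Word σ = List (Fin σ)

module _ {σ : ℕ} where

  IsPrefix IsFactor : Word σ → Word σ → Set
  IsPrefix = Prefix _≡_
  IsFactor = Infix _≡_

  -- Positions are 0-based here.
  OccursAt : Word σ → Word σ → ℕ → Set
  OccursAt s w p = IsPrefix s (drop p w)

  Covers : Word σ → Word σ → Set
  Covers s w = ∀ j → j < length w →
    ∃[ p ] OccursAt s w p × p ≤ j × j < p + length s

  IsSeed : Word σ → Word σ → Set
  IsSeed s x = IsFactor s x × (∃[ w ] Covers s w × IsFactor x w)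

  IsLeftSeed : Word σ → Word σ → Set
  IsLeftSeed s x = IsSeed s x × IsPrefix s x

  -- lseed(x) = ℓ, as the graph of the function lseed.
  IsLseed : Word σ → ℕ → Set
  IsLseed x ℓ = (∃[ s ] IsLeftSeed s x × length s ≡ ℓ)
              × (∀ s → IsLeftSeed s x → ℓ ≤ length s)

infix 4 _∈O_
_∈O_ : (ℕ → ℕ) → (ℕ → ℕ) → Set
f ∈O g = ∃[ c ] ∃[ n₀ ] (∀ n → n₀ ≤ n → f n ≤ c * g n)

-- A word RAM, programmed with structured control flow.  Registers and arrays
-- are named by naturals; a program mentions only finitely many of them, so the
-- arrays could be interleaved in a single memory at a constant-factor cost.
Reg Arr : Set
Reg = ℕ
Arr = ℕ

record State : Set where
  constructor state
  field
    reg : Reg → ℕ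
    mem : Arr → ℕ → ℕ
open State public

_[_↦_] : {A : Set} → (ℕ → A) → ℕ → A → (ℕ → A)
(f [ i ↦ v ]) j = if i ≡ᵇ j then v else f j

setReg : Reg → ℕ → State → State
setReg r v m = state (reg m [ r ↦ v ]) (mem m)

setMem : Arr → ℕ → ℕ → State → State
setMem a i v m = state (reg m) (mem m [ a ↦ mem m a [ i ↦ v ] ])

data Instr : Set where
  const : Reg → ℕ → Instr          -- r ← k
  move  : Reg → Reg → Instr        -- r ← s
  add   : Reg → Reg → Reg → Instr  -- r ← s + t
  sub   : Reg → Reg → Reg → Instr  -- r ← s ∸ t
  load  : Reg → Arr → Reg → Instr  -- r ← a[s]
  store : Arr → Reg → Reg → Instr  -- a[s] ← t

data Test : Set where
  eq lt le : Reg → Reg → Test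

data Program : Set where
  skip  : Program
  exec  : Instr → Program
  _⨾_   : Program → Program → Program
  cond  : Test → Program → Program → Program
  while : Test → Program → Program
infixr 5 _⨾_

⟦_⟧ : Test → State → Bool
⟦ eq r s ⟧ m = reg m r ≡ᵇ reg m s
⟦ lt r s ⟧ m = reg m r <ᵇ reg m s
⟦ le r s ⟧ m = reg m r ≤ᵇ reg m s

-- Single instructions on words of w bits.  An instruction whose result would
-- not fit in a word has no transition: the machine is stuck.  Only const and
-- add can create a value larger than those already stored.
data _⊢_⟶⟨_⟩_ (w : ℕ) (m : State) : Instr → State → Set where
  const : ∀ {r k} → k < 2 ^ w →
          w ⊢ m ⟶⟨ const r k ⟩ setReg r k m
  move  : ∀ {r s} →
          w ⊢ m ⟶⟨ move r s ⟩ setReg r (reg m s) m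
  add   : ∀ {r s t} → reg m s + reg m t < 2 ^ w →
          w ⊢ m ⟶⟨ add r s t ⟩ setReg r (reg m s + reg m t) m
  sub   : ∀ {r s t} →
          w ⊢ m ⟶⟨ sub r s t ⟩ setReg r (reg m s ∸ reg m t) m
  load  : ∀ {r a s} →
          w ⊢ m ⟶⟨ load r a s ⟩ setReg r (mem m a (reg m s)) m
  store : ∀ {a s t} →
          w ⊢ m ⟶⟨ store a s t ⟩ setMem a (reg m s) (reg m t) m

-- w ⊢⟨ p , m ⟩⇓⟨ m′ , c ⟩: on words of w bits, p started in m halts in m′
-- after c time units, where every instruction and every test costs one unit.
data _⊢⟨_,_⟩⇓⟨_,_⟩ (w : ℕ) : Program → State → State → ℕ → Set where
  skip    : ∀ {m} → w ⊢⟨ skip , m ⟩⇓⟨ m , 1 ⟩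
  exec    : ∀ {i m m′} → w ⊢ m ⟶⟨ i ⟩ m′ →
            w ⊢⟨ exec i , m ⟩⇓⟨ m′ , 1 ⟩
  seq     : ∀ {p q m m′ m″ c d} →
            w ⊢⟨ p , m ⟩⇓⟨ m′ , c ⟩ → w ⊢⟨ q , m′ ⟩⇓⟨ m″ , d ⟩ →
            w ⊢⟨ p ⨾ q , m ⟩⇓⟨ m″ , c + d ⟩
  condᵗ   : ∀ {b p q m m′ c} → ⟦ b ⟧ m ≡ true →
            w ⊢⟨ p , m ⟩⇓⟨ m′ , c ⟩ →
            w ⊢⟨ cond b p q , m ⟩⇓⟨ m′ , suc c ⟩
  condᶠ   : ∀ {b p q m m′ c} → ⟦ b ⟧ m ≡ false →
            w ⊢⟨ q , m ⟩⇓⟨ m′ , c ⟩ →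
            w ⊢⟨ cond b p q , m ⟩⇓⟨ m′ , suc c ⟩
  whileᵗ  : ∀ {b p m m′ m″ c d} → ⟦ b ⟧ m ≡ true →
            w ⊢⟨ p , m ⟩⇓⟨ m′ , c ⟩ → w ⊢⟨ while b p , m′ ⟩⇓⟨ m″ , d ⟩ →
            w ⊢⟨ while b p , m ⟩⇓⟨ m″ , suc (c + d) ⟩
  whileᶠ  : ∀ {b p m} → ⟦ b ⟧ m ≡ false →
            w ⊢⟨ while b p , m ⟩⇓⟨ m , 1 ⟩

-- The default 0 is returned beyond the end of the word.
letter : ∀ {σ} → Word σ → ℕ → ℕ
letter []      _       = 0
letter (a ∷ u) zero    = toℕ a
letter (a ∷ u) (suc i) = letter u i

-- Register 0 holds n, and array 0 holds u[1..n] in its cells 1, …, n;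
-- everything else is 0.
input : ∀ {σ} → Word σ → State
input u = state regs arrays
  where
  regs : Reg → ℕ
  regs zero    = length u
  regs (suc _) = 0

  arrays : Arr → ℕ → ℕ
  arrays zero    (suc i) = letter u i
  arrays _       _       = 0

-- The output array, read from its cells 1, …, n.
output : State → ℕ → ℕ
output m = mem m 1

-- p maps every word u over Fin σ to an array A[1..|u|] with R u i A[i] for all
-- i, in worst-case time T(|u|), on words of w(|u|) bits.
Computes : ∀ {σ} → Program → (w T : ℕ → ℕ) → (Word σ → ℕ → ℕ → Set) → Set
Computes {σ} p w T R = (u : Word σ) → let n = length u in
    n < 2 ^ w n × σ ≤ 2 ^ w n
  × (∃[ m ] ∃[ c ] (w n ⊢⟨ p , input u ⟩⇓⟨ m , c ⟩) × c ≤ T n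
      × (∀ i → 1 ≤ i → i ≤ n → R u i (output m i)))

{-# OPTIONS --safe #-}

-- A prefix s of x is a left seed of x iff s covers a prefix of x of length at
-- least per(x): an occurrence of s overhanging x leaves a border of x, and
-- conversely a covered prefix repeated with period per(x) stays covered.  So
-- LSeed[i] is the least ℓ ≤ i such that the longest prefix of u covered by
-- u[1..ℓ] has length at least i − B[i], where B is the border array.
--
-- Three loops run in linear time.  The first is the Knuth–Morris–Pratt
-- computation of B.  The second is Breslauer's computation of the shortest
-- covers C: either C[i] = C[B[i]] or C[i] = i, decided by the last prefix seen so
-- far that has C[B[i]] as a cover; the latter lengths are the array R.  The third
-- uses that LSeed is monotone and that a least left seed is its own shortest
-- cover: it advances a pointer ℓ until R[ℓ] + B[i] ≥ i.
module Submission where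

open import Defs
open import Data.Bool using (true; false; T)
open import Data.Empty using (⊥; ⊥-elim)
open import Data.Fin.Properties using (toℕ-injective)
open import Data.List using (List; []; _∷_; _++_; length; take; drop)
open import Data.List.Properties using (length-take; length-drop; length-++)
open import Data.List.Relation.Binary.Infix.Heterogeneous using (here; there)
open import Data.List.Relation.Binary.Prefix.Heterogeneous using ([]; _∷_)
open import Data.Nat
open import Data.Nat.Logarithm using (⌈log₂_⌉; ⌈log₂⌉-mono-≤; ⌈log₂2^n⌉≡n)
open import Data.Nat.Properties
open import Data.Nat.Tactic.RingSolver using (solve-∀)
open import Data.Product using (_×_; _,_; ∃-syntax; proj₁; proj₂)
open import Data.Sum using (inj₁; inj₂)
open import Function using (_∘_; _$_; case_of_)
open import Relation.Binary.PropositionalEquality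
open import Relation.Nullary using (¬_; yes; no; contradiction)

-- Arithmetic and array updates.

≤⇒∃+ : ∀ {m n} → m ≤ n → ∃[ o ] o + m ≡ n
≤⇒∃+ m≤n = _ , m∸n+n≡m m≤n

update-≡ : ∀ {A : Set} (f : ℕ → A) i {v} → (f [ i ↦ v ]) i ≡ v
update-≡ f i with i ≡ᵇ i in e≡
... | true  = refl
... | false = ⊥-elim (subst T e≡ (≡⇒≡ᵇ i i refl))

update-≢ : ∀ {A : Set} (f : ℕ → A) {i j v} → i ≢ j → (f [ i ↦ v ]) j ≡ f j
update-≢ f {i} {j} i≢j with i ≡ᵇ j in e≡
... | true  = contradiction (≡ᵇ⇒≡ i j (subst T (sym e≡) _)) i≢j
... | false = refl

-- The arrays are filled from cell 1 on, so exactly the cells 1, ..., i are constrained.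
Table : (ℕ → ℕ → Set) → (ℕ → ℕ) → ℕ → Set
Table P f i = ∀ j → j < i → P (f (suc j)) (suc j)

table-suc : ∀ P f {i v} → Table P f i → P v (suc i) → Table P (f [ suc i ↦ v ]) (suc i)
table-suc P f {i} t q j j<1+i with m<1+n⇒m<n∨m≡n j<1+i
... | inj₁ j<i  = subst (λ y → P y (suc j)) (sym (update-≢ f (λ i≡j → <⇒≢ j<i (sym (suc-injective i≡j))))) (t j j<i)
... | inj₂ refl = subst (λ y → P y (suc i)) (sym (update-≡ f (suc i))) q

-- Occurrences and covers among the prefixes of a sequence.

module Prefixes {A : Set} (x : ℕ → A) where

  -- The sequence is total, so an occurrence has no right end to respect; bounds such as `j ≤ n` in
  -- `Seed` keep it inside the word.
  Occ : ℕ → ℕ → Set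
  Occ ℓ p = ∀ {k} → k < ℓ → x (p + k) ≡ x k

  Occ-≤ : ∀ {ℓ m p} → m ≤ ℓ → Occ ℓ p → Occ m p
  Occ-≤ m≤ℓ o k<m = o (<-≤-trans k<m m≤ℓ)

  Occ-nest : ∀ {ℓ m p q} → Occ ℓ p → Occ m q → q + m ≤ ℓ → Occ m (p + q)
  Occ-nest {p = p} {q} o o′ q+m≤ℓ {k} k<m = begin
    x (p + q + k)   ≡⟨ cong x (+-assoc p q k) ⟩
    x (p + (q + k)) ≡⟨ o (<-≤-trans (+-monoʳ-< q k<m) q+m≤ℓ) ⟩
    x (q + k)       ≡⟨ o′ k<m ⟩
    x k             ∎
    where open ≡-Reasoning

  Occ-unnest : ∀ {ℓ m p q} → Occ ℓ p → Occ m (p + q) → q + m ≤ ℓ → Occ m q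
  Occ-unnest {p = p} {q} o o′ q+m≤ℓ {k} k<m = begin
    x (q + k)       ≡⟨ o (<-≤-trans (+-monoʳ-< q k<m) q+m≤ℓ) ⟨
    x (p + (q + k)) ≡⟨ cong x (+-assoc p q k) ⟨
    x (p + q + k)   ≡⟨ o′ k<m ⟩
    x k             ∎
    where open ≡-Reasoning

  -- The prefix of length ℓ covers the prefix of length j; step adds the
  -- occurrences from left to right, without a gap.
  data Cover (ℓ : ℕ) : ℕ → Set where
    start : Cover ℓ ℓ
    step  : ∀ {j p} → Cover ℓ j → Occ ℓ p → p ≤ j → j < p + ℓ → Cover ℓ (p + ℓ)

  cover-≤ : ∀ {ℓ j} → Cover ℓ j → ℓ ≤ j
  cover-≤ start                    = ≤-refl
  cover-≤ (step {p = p} _ _ _ _) = m≤n+m _ p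

  cover-zero : ∀ {j} → Cover 0 j → j ≡ 0
  cover-zero start = refl
  cover-zero (step {p = p} _ _ p≤j j<p) =
    contradiction j<p (≤⇒≯ (≤-trans (≤-reflexive (+-identityʳ p)) p≤j))

  cover-suffix : ∀ {ℓ j} → Cover ℓ j → ∃[ p ] p + ℓ ≡ j × Occ ℓ p
  cover-suffix start          = 0 , refl , λ _ → refl
  cover-suffix (step _ o _ _) = _ , refl , o

  -- Unlike `step`, this asks for no growth: if the new occurrence ends no later than the last one,
  -- the last one is dropped and the argument repeats. So it can also truncate a cover.
  cover-extend : ∀ {ℓ j p} → Cover ℓ j → Occ ℓ p → p ≤ j → Cover ℓ (p + ℓ)
  cover-extend {p = zero}  start o p≤j = start
  cover-extend {ℓ} {p = suc p} start o p≤j = step start o p≤j (s≤s (m≤n+m ℓ p))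
  cover-extend {ℓ} {p = p} c@(step {p = p′} d _ p′≤j′ _) o p≤j
    with <-≤-connex (p′ + ℓ) (p + ℓ)
  ... | inj₁ p< = step c o p≤j p<
  ... | inj₂ p≥ = cover-extend d o (≤-trans (+-cancelʳ-≤ ℓ p p′ p≥) p′≤j′)

  -- The occurrences of q that cover c, shifted by p, are appended one by one to the cover of j; as
  -- p ≤ j, the first leaves no gap.
  cover-nest : ∀ {q c p j} → Cover q c → Occ c p → Cover q j → p ≤ j → Cover q (p + c)
  cover-nest start o e p≤j = cover-extend e o p≤j
  cover-nest {q} {p = p} (step {p = r} d o′ r≤i i<) o e p≤j =
    subst (Cover q) (+-assoc p r q)
      (cover-extend (cover-nest d (Occ-≤ (<⇒≤ i<) o) e p≤j)
        (Occ-nest o o′ ≤-refl) (+-monoʳ-≤ p r≤i))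

  cover-trans : ∀ {q c j} → Cover q c → Cover c j → Cover q j
  cover-trans d start            = d
  cover-trans d (step e o p≤j _) = cover-nest d o (cover-trans d e) p≤j

  -- The last occurrence of q lies inside the given suffix of length c.
  cover-restrict : ∀ {q c j p} → Cover q j → p + c ≡ j → Occ c p → q ≤ c → Cover q c
  cover-restrict {q} {c} {p = p} d refl o q≤c
    with r , refl ← ≤⇒∃+ q≤c
       | s , e≡ , o′ ← cover-suffix d
    with refl ← +-cancelʳ-≡ q s (p + r) (trans e≡ (sym (+-assoc p r q)))
    -- The last occurrence of q, moved back by p, starts at r and ends at r + q = c; extending the
    -- cover of j by it truncates that cover to length c.
    = cover-extend d (Occ-unnest o o′ ≤-refl) (≤-trans (m≤m+n r q) (m≤n+m (r + q) p))

  cover-between : ∀ {q c j} → Cover q j → Cover c j → q ≤ c → Cover q c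
  cover-between d e q≤c with p , e≡ , o ← cover-suffix e = cover-restrict d e≡ o q≤c

  -- Without its last occurrence the cover reaches only i; that occurrence starts at i or earlier,
  -- since there is no gap, which bounds j by i + ℓ.
  cover-last : ∀ {ℓ j} → Cover ℓ j → ℓ < j → ∃[ i ] Cover ℓ i × i < j × j ≤ i + ℓ
  cover-last start          ℓ<ℓ = contradiction ℓ<ℓ (<-irrefl refl)
  cover-last (step d _ p≤i i<) _ = _ , d , i< , +-monoˡ-≤ _ p≤i

  cover-occ : ∀ {ℓ j t} → Cover ℓ j → t < j → ∃[ p ] p ≤ t × t < p + ℓ × p + ℓ ≤ j × Occ ℓ p
  cover-occ start t<j = 0 , z≤n , t<j , ≤-refl , λ _ → refl
  cover-occ {t = t} (step {j} {p} d o p≤j j<) t< with <-≤-connex t j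
  ... | inj₂ j≤t = p , ≤-trans p≤j j≤t , t< , ≤-refl , o
  ... | inj₁ t<j with q , q≤t , t<q+ℓ , q+ℓ≤j , o′ ← cover-occ d t<j =
    q , q≤t , t<q+ℓ , ≤-trans q+ℓ≤j (<⇒≤ j<) , o′

  -- Proper borders, and seeds expressed through them.

  Border : ℕ → ℕ → Set
  Border b i = ∃[ p ] suc p + b ≡ i × Occ b (suc p)

  LongestBorder : ℕ → ℕ → Set
  LongestBorder b i = Border b i × (∀ {r} → Border r i → r ≤ b)

  border-< : ∀ {b i} → Border b i → b < i
  border-< {b} (p , refl , _) = s≤s (m≤n+m b p)

  border-zero : ∀ {i} → Border 0 (suc i)
  border-zero = _ , +-identityʳ _ , λ ()

  border-trans : ∀ {r k i} → Border r k → Border k i → Border r i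
  border-trans {r} (p , refl , o) (q , refl , o′) =
    q + suc p , cong suc (+-assoc q (suc p) r) , Occ-nest o′ o ≤-refl

  -- Both borders are suffixes of the same prefix, so the shorter is a suffix of the longer.
  border-nest : ∀ {r k i} → Border r i → Border k i → r < k → Border r k
  border-nest {r} (p , e≡ , o) (q , refl , o′) r<k
    with d , refl ← ≤⇒∃+ r<k
    with refl ← +-cancelʳ-≡ r p (q + suc d)
                  (suc-injective (trans e≡ (cong suc (trans (cong (q +_) (+-suc d r)) (sym (+-assoc q (suc d) r))))))
    = d , sym (+-suc d r) , Occ-unnest o′ o (≤-reflexive (sym (+-suc d r)))

  border-init : ∀ {r i} → Border (suc r) (suc i) → Border r i
  border-init {r} (p , e≡ , o) =
    p , suc-injective (trans (cong suc (sym (+-suc p r))) e≡) , Occ-≤ (n≤1+n r) o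

  border-last : ∀ {r i} → Border (suc r) (suc i) → x i ≡ x r
  border-last b@(_ , _ , o) = trans (cong x (sym (proj₁ (proj₂ (border-init b))))) (o ≤-refl)

  border-extend : ∀ {k i} → Border k i → x i ≡ x k → Border (suc k) (suc i)
  border-extend {k} (p , refl , o) e≡ = p , cong suc (+-suc p k) , λ j<1+k → occ (m<1+n⇒m<n∨m≡n j<1+k)
    where
    occ : ∀ {j} → _ → x (suc p + j) ≡ x j
    occ (inj₁ j<k)  = o j<k
    occ (inj₂ refl) = e≡

  cover-border : ∀ {c i} → Cover c i → c < i → Border c i
  cover-border d c<i with cover-suffix d
  ... | zero  , refl , _ = contradiction c<i (<-irrefl refl)
  ... | suc p , e≡   , o = p , e≡ , o

  -- The inequality `i ≤ j + b` says that j is at least the period i - b. The covered length j may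
  -- exceed i, up to the length n of the whole word, so that the final array R can supply it.
  Seed : ℕ → ℕ → ℕ → Set
  Seed n ℓ i = ℓ ≤ i × ∃[ j ] j ≤ n × Cover ℓ j × ∃[ b ] Border b i × i ≤ j + b

  LeastSeed : ℕ → ℕ → ℕ → Set
  LeastSeed n ℓ i = Seed n ℓ i × (∀ {s} → Seed n s i → ℓ ≤ s)

  seed-self : ∀ {n i} → suc i ≤ n → Seed n (suc i) (suc i)
  seed-self i<n = ≤-refl , _ , i<n , start , 0 , border-zero , m≤m+n _ 0

  -- Deleting the last letter shortens a nonempty border by one and keeps the period; with an empty
  -- border, j alone is long enough.
  seed-pred : ∀ {n ℓ i} → Seed n ℓ (suc (suc i)) → ℓ ≤ suc i → Seed n ℓ (suc i)
  seed-pred (_ , j , j≤n , d , zero  , β , i≤j+b) ℓ≤ =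
    ℓ≤ , j , j≤n , d , 0 , border-zero , ≤-trans (n≤1+n _) i≤j+b
  seed-pred (_ , j , j≤n , d , suc b , β , i≤j+b) ℓ≤ =
    ℓ≤ , j , j≤n , d , b , border-init β , s≤s⁻¹ (≤-trans i≤j+b (≤-reflexive (+-suc j b)))

  -- This makes lseed monotone: the pointer of the third loop never moves back.
  least-seed-suc : ∀ {n ℓ i} → suc i ≤ n → (∀ {s} → Seed n s (suc i) → ℓ ≤ s) →
                   ∀ {s} → Seed n s (suc (suc i)) → ℓ ≤ s
  least-seed-suc i<n least {s} sd with <-≤-connex s (suc (suc _))
  ... | inj₁ s<2+i = least (seed-pred sd (s≤s⁻¹ s<2+i))
  ... | inj₂ 2+i≤s = ≤-trans (least (seed-self i<n)) (≤-trans (n≤1+n _) 2+i≤s)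

  -- State of the border computation.

  record Failure (B : ℕ → ℕ) (i k : ℕ) : Set where
    field
      borders : Table LongestBorder B i
      border  : Border k i
      -- All candidates longer than k have been refuted for the next prefix.
      maximal : ∀ {r} → Border (suc r) (suc i) → r ≤ k

  module _ {B i k} (F : Failure B i k) where
    open Failure F

    failure-match : x k ≡ x i → Failure (B [ suc i ↦ suc k ]) (suc i) (suc k)
    failure-match xk≡xi = record
      { borders = table-suc LongestBorder B borders (longer , λ { {zero} _ → z≤n ; {suc r} β → s≤s (maximal β) })
      ; border  = longer
      ; maximal = bound ∘ border-init
      }
      where
      longer = border-extend border (sym xk≡xi)
      bound : ∀ {r} → Border r (suc i) → r ≤ suc k
      bound {zero}  _ = z≤n
      bound {suc r} β = s≤s (maximal β)

    failure-none : x k ≢ x i → k ≡ 0 → Failure (B [ suc i ↦ 0 ]) (suc i) 0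
    failure-none xk≢xi refl = record
      { borders = table-suc LongestBorder B borders (border-zero , bound)
      ; border  = border-zero
      ; maximal = bound ∘ border-init
      }
      where
      bound : ∀ {r} → Border r (suc i) → r ≤ 0
      bound {zero}  _ = z≤n
      bound {suc r} β with refl ← n≤0⇒n≡0 (maximal β) = contradiction (sym (border-last β)) xk≢xi

  -- The mismatch rules out k itself; any shorter candidate is a border of the prefix of length k,
  -- hence at most B k.
  failure-fallback : ∀ {B i k} → Failure B i k → x k ≢ x i → k ≢ 0 → Failure B i (B k) × B k < k
  failure-fallback {k = zero}  F xk≢xi k≢0 = contradiction refl k≢0
  failure-fallback {k = suc k} F xk≢xi _
    with βk , longest ← Failure.borders F k (<-trans (n<1+n k) (border-< (Failure.border F))) = record
      { borders = borders
      ; border  = border-trans βk border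
      ; maximal = λ γ → longest (border-nest (border-init γ) border
          (≤∧≢⇒< (maximal γ) λ { refl → xk≢xi (sym (border-last γ)) }))
      } , border-< βk
    where open Failure F

  -- Shortest covers and the reach of each cover.

  ShortestCover : ℕ → ℕ → Set
  ShortestCover c j = Cover c j × (∀ {d} → Cover d j → c ≤ d)

  -- R ℓ is the greatest j ≤ i with C j = ℓ, and 0 if there is none.
  record Reach (C R : ℕ → ℕ) (i : ℕ) : Set where
    field
      C-zero   : C 0 ≡ 0
      covers   : Table ShortestCover C i
      R-≤      : ∀ ℓ → R ℓ ≤ i
      R-cover  : ∀ ℓ → 0 < R ℓ → Cover ℓ (R ℓ)
      R-latest : Table (λ c j → j ≤ R c) C i

  reach-update : ∀ {C R i c} → Reach C R i → ShortestCover c (suc i) →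
                 Reach (C [ suc i ↦ c ]) (R [ c ↦ suc i ]) (suc i)
  reach-update {C} {R} {i} {c} K sc = record
    { C-zero   = C-zero
    ; covers   = table-suc ShortestCover C covers sc
    ; R-≤      = R′-≤
    ; R-cover  = R′-cover
    ; R-latest = table-suc (λ c′ j → j ≤ (R [ c ↦ suc i ]) c′) C
        -- The entries of R were at most i, so writing `suc i` lowers none of them.
        (λ j j<i → ≤-trans (R-latest j j<i) (grows (C (suc j))))
        (≤-reflexive (sym (update-≡ R c)))
    }
    where
    open Reach K
    R′ = R [ c ↦ suc i ]

    R′-≤ : ∀ ℓ → R′ ℓ ≤ suc i
    R′-≤ ℓ with c ≟ ℓ
    ... | yes refl rewrite update-≡ R c {suc i} = ≤-refl
    ... | no c≢ℓ rewrite update-≢ R {v = suc i} c≢ℓ = m≤n⇒m≤1+n (R-≤ ℓ)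

    R′-cover : ∀ ℓ → 0 < R′ ℓ → Cover ℓ (R′ ℓ)
    R′-cover ℓ with c ≟ ℓ
    ... | yes refl rewrite update-≡ R c {suc i} = λ _ → proj₁ sc
    ... | no c≢ℓ rewrite update-≢ R {v = suc i} c≢ℓ = R-cover ℓ

    grows : ∀ ℓ → R ℓ ≤ R′ ℓ
    grows ℓ with c ≟ ℓ
    ... | yes refl rewrite update-≡ R c {suc i} = m≤n⇒m≤1+n (R-≤ c)
    ... | no c≢ℓ rewrite update-≢ R {v = suc i} c≢ℓ = ≤-refl

  module _ {C R i} (K : Reach C R i) where
    open Reach K

    reach-C-≤ : ∀ {b} → b ≤ i → C b ≤ i
    reach-C-≤ {zero}  _   = ≤-trans (≤-reflexive C-zero) z≤n
    reach-C-≤ {suc b} b<i = ≤-trans (cover-≤ (proj₁ (covers b b<i))) b<i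

    -- The shortest cover of the prefix of length `suc j` also covers c; as c has no shorter cover,
    -- the two are equal, and `R-latest` applies.
    reach-latest : ∀ {c j} → Cover c (suc j) → suc j ≤ i → (∀ {d} → Cover d c → c ≤ d) → suc j ≤ R c
    reach-latest {c} {j} d j<i irreducible
      with e , shortest ← covers j j<i
      with refl ← ≤-antisym (shortest d) (irreducible (cover-between e d (shortest d)))
      = R-latest j j<i

    module _ {b} (longest : LongestBorder b (suc i)) where

      -- A proper cover is a border, so it is no longer than the longest border b and covers it as a
      -- suffix.
      cover-longest : ∀ {c} → Cover c (suc i) → c < suc i → Cover c b
      cover-longest d c≤i with _ , e≡ , o ← proj₁ longest =
        cover-restrict d e≡ o (proj₂ longest (cover-border d c≤i))

    -- The test says that the prefix covered by q = C b reaches the start of the last occurrence of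
    -- q in the border suffix, so that occurrence can be appended. Any shorter proper cover would
    -- cover b too.
    extension : ∀ {b} → LongestBorder b (suc i) → suc i ≤ R (C b) + C b → ShortestCover (C b) (suc i)
    -- For an empty border the test cannot succeed: C 0 = 0, and the empty prefix covers nothing of
    -- positive length.
    extension {zero} _ i<R+q rewrite C-zero | +-identityʳ (R 0) =
      contradiction (cover-zero (R-cover 0 0<R)) (λ R≡0 → <⇒≢ 0<R (sym R≡0))
      where 0<R = <-≤-trans z<s i<R+q
    extension {suc b} L@((p , e≡ , o) , _) i<R+q
      with d , shortest ← covers b (s<s⁻¹ (border-< (proj₁ L)))
      with s , e≡′ , o′ ← cover-suffix d =
      subst (Cover q) end (cover-extend (R-cover q (<-≤-trans z<s p+s≤R)) (Occ-nest o o′ (≤-reflexive e≡′)) p+s≤R) ,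
      minimal
      where
      q = C (suc b)
      end : suc p + s + q ≡ suc i
      end = trans (+-assoc (suc p) s q) (trans (cong (suc p +_) e≡′) e≡)
      p+s≤R : suc p + s ≤ R q
      p+s≤R = +-cancelʳ-≤ q (suc p + s) (R q) (≤-trans (≤-reflexive end) i<R+q)
      minimal : ∀ {c} → Cover c (suc i) → q ≤ c
      minimal {c} e with <-≤-connex c (suc i)
      ... | inj₁ c≤i = shortest (cover-longest L e c≤i)
      ... | inj₂ i<c = ≤-trans (cover-≤ d) (≤-trans (<⇒≤ (border-< (proj₁ L))) i<c)

    -- A proper cover c would cover b, so C b would cover c and hence the whole prefix. Dropping its
    -- last occurrence leaves a length j that R (C b) has recorded, contradicting the failed test.
    no-extension : ∀ {b} → LongestBorder b (suc i) → R (C b) + C b < suc i → ShortestCover (suc i) (suc i)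
    no-extension {b} L R+q≤i = start , minimal
      where
      refute : ∀ {b c} → LongestBorder b (suc i) → R (C b) + C b < suc i → Cover c (suc i) → Cover c b → ⊥
      refute {zero} _ _ d e with refl ← n≤0⇒n≡0 (cover-≤ e) = case cover-zero d of λ ()
      refute {suc b} {c} L R+q≤i d e
        with f , shortest ← covers b (s<s⁻¹ (border-< (proj₁ L)))
        with j , g , j≤i , i<j+q ← cover-last
               (cover-trans (cover-between f e (shortest e)) d)
               (≤-<-trans (cover-≤ f) (border-< (proj₁ L)))
        = <⇒≱ R+q≤i (≤-trans i<j+q (+-monoˡ-≤ (C (suc b)) (reached j g j≤i)))
        where
        reached : ∀ j → Cover (C (suc b)) j → j < suc i → j ≤ R (C (suc b))
        reached zero    _ _   = z≤n
        reached (suc j) g j<i = reach-latest g (s≤s⁻¹ j<i) (λ h → shortest (cover-trans h f))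

      minimal : ∀ {c} → Cover c (suc i) → suc i ≤ c
      minimal {c} d with <-≤-connex c (suc i)
      ... | inj₁ c≤i = ⊥-elim (refute L R+q≤i d (cover-longest L d c≤i))
      ... | inj₂ i<c = i<c

  -- The monotone pointer of the third loop.

  module _ {n} B {C R} (L : Table LongestBorder B n) (K : Reach C R n) where
    open Reach K

    -- R ℓ and the longest border witness the seed; since the border is proper, the test forces R ℓ
    -- to be positive, as `R-cover` demands.
    pointer-stop : ∀ {ℓ i} → i < n → (∀ {s} → Seed n s (suc i) → ℓ ≤ s) →
                   suc i ≤ R ℓ + B (suc i) → LeastSeed n ℓ (suc i)
    pointer-stop {ℓ} {i} i<n least i<R+b =
      (least (seed-self i<n) , R ℓ , R-≤ ℓ , R-cover ℓ 0<R , _ , proj₁ (L i i<n) , i<R+b) , least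
      where
      0<R : 0 < R ℓ
      0<R = +-cancelʳ-< (B (suc i)) 0 (R ℓ) (<-≤-trans (border-< (proj₁ (L i i<n))) i<R+b)

    -- If ℓ itself were a seed then, being least, it would be a shortest cover of
    -- the prefix witnessing this, and R ℓ would be large enough.
    pointer-advance : ∀ {ℓ i} → i < n → (∀ {s} → Seed n s (suc i) → ℓ ≤ s) →
                      R ℓ + B (suc i) < suc i → ∀ {s} → Seed n s (suc i) → suc ℓ ≤ s
    pointer-advance {ℓ} {i} i<n least R+b≤i {s} sd@(ℓ≤i , j , j≤n , d , b , β , i<j+b) =
      ≤∧≢⇒< (least sd) λ { refl → <⇒≱ R+b≤i (≤-trans i<j+b (+-mono-≤ (reached j j≤n d i<j+b) (proj₂ (L i i<n) β))) }
      where
      reached : ∀ j → j ≤ n → Cover ℓ j → suc i ≤ j + b → j ≤ R ℓ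
      reached zero    _   _ _     = z≤n
      reached (suc j) j<n e i<j+b = reach-latest K e j<n λ f →
        least (≤-trans (cover-≤ f) (least (seed-self i<n)) , suc j , j<n , cover-trans f e , b , β , i<j+b)

-- Occurrences in lists, letter by letter.

letter-drop : ∀ {σ} p (w : Word σ) k → letter (drop p w) k ≡ letter w (p + k)
letter-drop zero    w       k = refl
letter-drop (suc p) []      k = refl
letter-drop (suc p) (_ ∷ w) k = letter-drop p w k

letter-take : ∀ {σ i k} (w : Word σ) → k < i → letter (take i w) k ≡ letter w k
letter-take {i = suc i}             []      _         = refl
letter-take {i = suc i} {k = zero}  (_ ∷ w) _         = refl
letter-take {i = suc i} {k = suc k} (_ ∷ w) (s≤s k<i) = letter-take w k<i

letter-++ˡ : ∀ {σ k} (v w : Word σ) → k < length v → letter (v ++ w) k ≡ letter v k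
letter-++ˡ {k = zero}  (_ ∷ v) w _         = refl
letter-++ˡ {k = suc k} (_ ∷ v) w (s≤s k<v) = letter-++ˡ v w k<v

letter-++ʳ : ∀ {σ} (v w : Word σ) k → letter (v ++ w) (length v + k) ≡ letter w k
letter-++ʳ []      w k = refl
letter-++ʳ (_ ∷ v) w k = letter-++ʳ v w k

length-take-≤ : ∀ {A : Set} {i} (w : List A) → i ≤ length w → length (take i w) ≡ i
length-take-≤ {i = i} w i≤w = trans (length-take i w) (m≤n⇒m⊓n≡m i≤w)

Matches : ∀ {σ} → Word σ → Word σ → ℕ → Set
Matches s w p = p + length s ≤ length w × (∀ {k} → k < length s → letter w (p + k) ≡ letter s k)

prefix⇒matches : ∀ {σ} {s w : Word σ} → IsPrefix s w → Matches s w 0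
prefix⇒matches [] = z≤n , λ ()
prefix⇒matches {s = a ∷ s} {w = a ∷ w} (refl ∷ π) with s≤w , same ← prefix⇒matches π =
  s≤s s≤w , λ { {zero} _ → refl ; {suc k} (s≤s k<s) → same k<s }

matches⇒prefix : ∀ {σ} {s w : Word σ} → Matches s w 0 → IsPrefix s w
matches⇒prefix {s = []} _ = []
matches⇒prefix {s = _ ∷ s} {w = _ ∷ w} (s≤s s≤w , same) =
  sym (toℕ-injective (same z<s)) ∷ matches⇒prefix (s≤w , λ k<s → same (s<s k<s))

-- The bound on p concerns the empty word, which also occurs beyond the end of w because `drop` then
-- returns the empty list.
occurs⇒matches : ∀ {σ p} {s w : Word σ} → p ≤ length w → OccursAt s w p → Matches s w p
occurs⇒matches {p = p} {s} {w} p≤w π with s≤w∸p , same ← prefix⇒matches π =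
  ≤-trans (+-monoʳ-≤ p (≤-trans s≤w∸p (≤-reflexive (length-drop p w)))) (≤-reflexive (m+[n∸m]≡n p≤w)) ,
  λ k<s → trans (sym (letter-drop p w _)) (same k<s)

matches⇒occurs : ∀ {σ p} {s w : Word σ} → Matches s w p → OccursAt s w p
matches⇒occurs {p = p} {s} {w} (p+s≤w , same) = matches⇒prefix
  ( ≤-trans (m+n≤o⇒m≤o∸n (length s) (≤-trans (≤-reflexive (+-comm (length s) p)) p+s≤w))
            (≤-reflexive (sym (length-drop p w)))
  , λ k<s → trans (letter-drop p w _) (same k<s))

factor⇒matches : ∀ {σ} {s w : Word σ} → IsFactor s w → ∃[ p ] Matches s w p
factor⇒matches (here π) = 0 , prefix⇒matches π
factor⇒matches (there ι) with p , p+s≤w , same ← factor⇒matches ι = suc p , s≤s p+s≤w , same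

-- Left seeds of prefixes correspond to covered prefixes with a border.

module _ {σ} (u : Word σ) where
  open Prefixes (letter u)

  take-matches : ∀ {m} {w : Word σ} → m ≤ length u → m ≤ length w →
                 (∀ {t} → t < m → letter w t ≡ letter u t) → IsPrefix (take m u) w
  take-matches {m} m≤u m≤w same = matches⇒prefix
    ( subst (_≤ _) (sym (length-take-≤ u m≤u)) m≤w
    , λ t<m → case subst (_ <_) (length-take-≤ u m≤u) t<m of λ t<m → trans (same t<m) (sym (letter-take u t<m)))

  seed⇒leftSeed : ∀ {ℓ i} → i ≤ length u → Seed (length u) ℓ i → IsLeftSeed (take ℓ u) (take i u)
  seed⇒leftSeed {ℓ} {i} i≤u (ℓ≤i , j , j≤u , d , b , (p′ , p+b≡i , border) , i≤j+b) =
    let w , covered , _ , x≼w = extension≤ i i ≤-refl ≤-refl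
    in (here s≼x , w , covered , here x≼w) , s≼x
    where
    p = suc p′
    s = take ℓ u

    |s| : length s ≡ ℓ
    |s| = length-take-≤ u (≤-trans ℓ≤i i≤u)

    |x| : length (take i u) ≡ i
    |x| = length-take-≤ u i≤u

    p≤j : p ≤ j
    p≤j = +-cancelʳ-≤ b p j (≤-trans (≤-reflexive p+b≡i) i≤j+b)

    s≼x : IsPrefix s (take i u)
    s≼x = take-matches (≤-trans ℓ≤i i≤u) (subst (ℓ ≤_) (sym |x|) ℓ≤i)
            (λ t<ℓ → letter-take u (<-≤-trans t<ℓ ℓ≤i))

    occ⇒matches : ∀ {q m} {w : Word σ} → Occ ℓ q → q + ℓ ≤ m → m ≤ length w →
                  (∀ {t} → t < m → letter w t ≡ letter u t) → OccursAt s w q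
    occ⇒matches {q} o q+ℓ≤m m≤w same = matches⇒occurs
      ( ≤-trans (≤-reflexive (cong (q +_) |s|)) (≤-trans q+ℓ≤m m≤w)
      , λ k<s → case subst (_ <_) |s| k<s of λ k<ℓ →
          trans (same (<-≤-trans (+-monoʳ-< q k<ℓ) q+ℓ≤m))
                (trans (o k<ℓ) (sym (letter-take u k<ℓ))))

    Extension : ℕ → Word σ → Set
    Extension m w = Covers s w × m ≤ length w × IsPrefix (take m u) w

    -- The period p is at most j, so a covered extension of the suffix starting
    -- at p becomes a covered extension of the whole by prepending a period.
    extension≤ : ∀ f m → m ≤ f → m ≤ i → ∃[ w ] Extension m w
    extension≤ f m m≤f m≤i with <-≤-connex j m
    extension≤ f m m≤f m≤i | inj₂ m≤j = take j u , covers , subst (m ≤_) (sym |j|) m≤j ,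
      take-matches (≤-trans m≤i i≤u) (subst (m ≤_) (sym |j|) m≤j) (λ t<m → letter-take u (<-≤-trans t<m m≤j))
      where
      |j| = length-take-≤ u j≤u
      covers : Covers s (take j u)
      covers t t<j with q , q≤t , t<q+ℓ , q+ℓ≤j , o ← cover-occ d (subst (t <_) |j| t<j) =
        q , occ⇒matches o q+ℓ≤j (≤-reflexive (sym |j|)) (letter-take u) , q≤t ,
        subst (λ l → t < q + l) (sym |s|) t<q+ℓ
    extension≤ zero    m m≤f m≤i | inj₁ j<m = contradiction (<-≤-trans j<m m≤f) λ ()
    extension≤ (suc f) m m≤f m≤i | inj₁ j<m
      with m′ , refl ← m≤n⇒∃[o]m+o≡n (≤-trans p≤j (<⇒≤ j<m))
      with w′ , covered , m′≤w′ , π ← extension≤ f m′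
             (≤-trans (m≤n+m m′ p′) (s≤s⁻¹ m≤f)) (≤-trans (m≤n+m m′ p) m≤i)
      = w , covers , m≤w , take-matches (≤-trans m≤i i≤u) m≤w same
      where
      |p| : length (take p u) ≡ p
      |p| = length-take-≤ u (≤-trans p≤j j≤u)
      w = take p u ++ w′
      |w| : length w ≡ p + length w′
      |w| = trans (length-++ (take p u)) (cong (_+ length w′) |p|)
      m≤w : p + m′ ≤ length w
      m≤w = subst (p + m′ ≤_) (sym |w|) (+-monoʳ-≤ p m′≤w′)
      m′≤b : m′ ≤ b
      m′≤b = +-cancelˡ-≤ p m′ b (≤-trans m≤i (≤-reflexive (sym p+b≡i)))
      right : ∀ t → letter w (p + t) ≡ letter w′ t
      right t = trans (cong (λ l → letter w (l + t)) (sym |p|)) (letter-++ʳ (take p u) w′ t)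
      same : ∀ {t} → t < p + m′ → letter w t ≡ letter u t
      same {t} t<m with <-≤-connex t p
      ... | inj₁ t<p = trans (letter-++ˡ (take p u) w′ (subst (t <_) (sym |p|) t<p)) (letter-take u t<p)
      -- Past the first period, w copies the beginning of u; the border, of length b ≥ m′,
      -- identifies this with u shifted by p.
      ... | inj₂ p≤t with t′ , refl ← m≤n⇒∃[o]m+o≡n p≤t = begin
        letter w (p + t′)       ≡⟨ right t′ ⟩
        letter w′ t′            ≡⟨ proj₂ (prefix⇒matches π) (subst (t′ <_) (sym |m′|) t′<m′) ⟩
        letter (take m′ u) t′   ≡⟨ letter-take u t′<m′ ⟩
        letter u t′             ≡⟨ border (<-≤-trans t′<m′ m′≤b) ⟨
        letter u (p + t′)       ∎
        where
        open ≡-Reasoning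
        t′<m′ = +-cancelˡ-< p t′ m′ t<m
        |m′| = length-take-≤ u (≤-trans (≤-trans (m≤n+m m′ p) m≤i) i≤u)
      covers : Covers s w
      covers t t<w with <-≤-connex t p
      -- The first p ≤ j positions are served by the occurrences covering the prefix of length j, on
      -- which w agrees with u.
      ... | inj₁ t<p with q , q≤t , t<q+ℓ , q+ℓ≤j , o ← cover-occ d (<-≤-trans t<p p≤j) =
        q , occ⇒matches o (≤-trans q+ℓ≤j (<⇒≤ j<m)) m≤w same , q≤t , subst (λ l → t < q + l) (sym |s|) t<q+ℓ
      ... | inj₂ p≤t with t′ , refl ← m≤n⇒∃[o]m+o≡n p≤t
        with t′<w′ ← +-cancelˡ-< p t′ (length w′) (subst (p + t′ <_) |w| t<w)
        with q , π , q≤t′ , t′<q+s ← covered t′ t′<w′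
        with q+s≤w′ , same′ ← occurs⇒matches {s = s} {w = w′} (≤-trans q≤t′ (<⇒≤ t′<w′)) π
        = p + q
        , matches⇒occurs {s = s} {w = w}
            ( ≤-trans (≤-reflexive (+-assoc p q (length s))) (≤-trans (+-monoʳ-≤ p q+s≤w′) (≤-reflexive (sym |w|)))
            , λ {k} k<s → trans (cong (letter w) (+-assoc p q k)) (trans (right (q + k)) (same′ k<s)))
        , +-monoʳ-≤ p q≤t′
        , subst (p + t′ <_) (sym (+-assoc p q (length s))) (+-monoʳ-< p t′<q+s)

  leftSeed⇒seed : ∀ {s i} → suc i ≤ length u → IsLeftSeed s (take (suc i) u) → Seed (length u) (length s) (suc i)
  leftSeed⇒seed {s} {i′} i≤u ((_ , w , covered , x≼w) , s≼x)
    with s≤x , s≡x ← prefix⇒matches s≼x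
       | a , a+x≤w , x≡w ← factor⇒matches x≼w
    = search i ℓ (m≤m+n i ℓ) ℓ≤i start
    where
    i = suc i′
    ℓ = length s

    |x| : length (take i u) ≡ i
    |x| = length-take-≤ u i≤u

    ℓ≤i : ℓ ≤ i
    ℓ≤i = subst (ℓ ≤_) |x| s≤x

    s≡u : ∀ {k} → k < ℓ → letter s k ≡ letter u k
    s≡u k<ℓ = trans (sym (s≡x k<ℓ)) (letter-take u (<-≤-trans k<ℓ ℓ≤i))

    w≡u : ∀ {k} → k < i → letter w (a + k) ≡ letter u k
    w≡u {k} k<i = trans (x≡w (subst (k <_) (sym |x|) k<i)) (letter-take u k<i)

    a+i≤w : a + i ≤ length w
    a+i≤w = subst (λ l → a + l ≤ length w) |x| a+x≤w

    -- The occurrence covering the first position after a covered prefix either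
    -- prolongs that prefix or overhangs x, which yields a border.
    search : ∀ f j → i ≤ f + j → j ≤ i → Cover ℓ j → Seed (length u) ℓ i
    search f j i≤f+j j≤i d with <-≤-connex j i
    search f j i≤f+j j≤i d | inj₂ i≤j =
      ℓ≤i , j , ≤-trans j≤i i≤u , d , 0 , border-zero , ≤-trans i≤j (m≤m+n j 0)
    search zero    j i≤f+j j≤i d | inj₁ j<i = contradiction i≤f+j (<⇒≱ j<i)
    search (suc f) j i≤f+j j≤i d | inj₁ j<i
      with q , π , q≤a+j , a+j<q+ℓ ← covered (a + j) (<-≤-trans (+-monoʳ-< a j<i) a+i≤w)
      -- As ℓ ≤ j, an occurrence containing position a + j starts after a. Its offset p in x is thus
      -- positive, which makes a resulting border proper.
      with p′ , refl ← m≤n⇒∃[o]m+o≡n (+-cancelʳ-< ℓ a q (≤-<-trans (+-monoʳ-≤ a (cover-≤ d)) a+j<q+ℓ))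
      with s≡w ← proj₂ (occurs⇒matches {s = s} {w = w} (≤-trans q≤a+j (≤-trans (+-monoʳ-≤ a j≤i) a+i≤w)) π)
      = advance (<-≤-connex i (p + ℓ))
      where
      p = suc p′

      q≡a+p : suc a + p′ ≡ a + p
      q≡a+p = sym (+-suc a p′)

      p≤j : p ≤ j
      p≤j = +-cancelˡ-≤ a p j (subst (_≤ a + j) q≡a+p q≤a+j)

      j<p+ℓ : j < p + ℓ
      j<p+ℓ = +-cancelˡ-< a j (p + ℓ) (subst (a + j <_) (trans (cong (_+ ℓ) q≡a+p) (+-assoc a p ℓ)) a+j<q+ℓ)

      occ : ∀ {k} → k < ℓ → p + k < i → letter u (p + k) ≡ letter u k
      occ {k} k<ℓ p+k<i = begin
        letter u (p + k)          ≡⟨ w≡u p+k<i ⟨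
        letter w (a + (p + k))    ≡⟨ cong (letter w) (+-assoc a p k) ⟨
        letter w (a + p + k)      ≡⟨ cong (λ q → letter w (q + k)) q≡a+p ⟨
        letter w (suc a + p′ + k) ≡⟨ s≡w k<ℓ ⟩
        letter s k                ≡⟨ s≡u k<ℓ ⟩
        letter u k                ∎
        where open ≡-Reasoning

      advance : _ → Seed (length u) ℓ i
      advance (inj₂ p+ℓ≤i) = search f (p + ℓ)
        (≤-trans i≤f+j (≤-trans (≤-reflexive (sym (+-suc f j))) (+-monoʳ-≤ f j<p+ℓ))) p+ℓ≤i
        (step d (λ k<ℓ → occ k<ℓ (<-≤-trans (+-monoʳ-< p k<ℓ) p+ℓ≤i)) p≤j j<p+ℓ)
      advance (inj₁ i<p+ℓ) with b , p+b≡i ← m≤n⇒∃[o]m+o≡n (≤-trans p≤j j≤i) =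
        ℓ≤i , j , ≤-trans j≤i i≤u , d , b
        , (p′ , p+b≡i , λ {k} k<b →
            let p+k<i = <-≤-trans (+-monoʳ-< p k<b) (≤-reflexive p+b≡i)
            in occ (+-cancelˡ-< p k ℓ (<-trans p+k<i i<p+ℓ)) p+k<i)
        , ≤-trans (≤-reflexive (sym p+b≡i)) (+-monoˡ-≤ b p≤j)

  leastSeed⇒lseed : ∀ {ℓ i} → suc i ≤ length u → LeastSeed (length u) ℓ (suc i) → IsLseed (take (suc i) u) ℓ
  leastSeed⇒lseed {ℓ} i≤u (seed , least) =
    (take ℓ u , seed⇒leftSeed i≤u seed , length-take-≤ u (≤-trans (proj₁ seed) i≤u)) ,
    λ s σ → least (leftSeed⇒seed i≤u σ)

-- Total correctness with time bounds.

record Exec (w : ℕ) (p : Program) (m : State) (T : ℕ) (Q : State → Set) : Set where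
  constructor halts
  field
    {final} : State
    {cost}  : ℕ
    run     : w ⊢⟨ p , m ⟩⇓⟨ final , cost ⟩
    cost≤   : cost ≤ T
    post    : Q final

≡true⇒T : ∀ {b} → b ≡ true → T b
≡true⇒T refl = _

≡false⇒¬T : ∀ {b} → b ≡ false → ¬ T b
≡false⇒¬T refl ()

module _ {w : ℕ} where

  -- The slack d lets branches of different lengths share one bound in `exec-cond`.
  exec-last : ∀ {i m m′ d Q} → w ⊢ m ⟶⟨ i ⟩ m′ → Q m′ → Exec w (exec i) m (suc d) Q
  exec-last t q = halts (exec t) (s≤s z≤n) q

  exec-then : ∀ {i p m m′ d Q} → w ⊢ m ⟶⟨ i ⟩ m′ → Exec w p m′ d Q → Exec w (exec i ⨾ p) m (suc d) Q
  exec-then t (halts r c q) = halts (seq (exec t) r) (s≤s c) q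

  exec-seq : ∀ {p q m c d P Q} → Exec w p m c P → (∀ {m′} → P m′ → Exec w q m′ d Q) →
             Exec w (p ⨾ q) m (c + d) Q
  exec-seq (halts r c≤ p) next with halts r′ d≤ q ← next p = halts (seq r r′) (+-mono-≤ c≤ d≤) q

  exec-cond : ∀ {b p q m d Q} →
              (⟦ b ⟧ m ≡ true → Exec w p m d Q) → (⟦ b ⟧ m ≡ false → Exec w q m d Q) →
              Exec w (cond b p q) m (suc d) Q
  exec-cond {b} {m = m} ifTrue ifFalse with ⟦ b ⟧ m in e≡
  ... | true  with halts r c q ← ifTrue refl  = halts (condᵗ e≡ r) (s≤s c) q
  ... | false with halts r c q ← ifFalse refl = halts (condᶠ e≡ r) (s≤s c) q

  -- The index of the invariant bounds the number of remaining iterations.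
  exec-while : ∀ {b p d} (Inv : ℕ → State → Set) →
               (∀ {m} → Inv 0 m → ⟦ b ⟧ m ≡ true → ⊥) →
               (∀ {f m} → Inv (suc f) m → ⟦ b ⟧ m ≡ true → Exec w p m d (Inv f)) →
               ∀ f {m} → Inv f m →
               Exec w (while b p) m (suc (f * suc d)) (λ m′ → ⟦ b ⟧ m′ ≡ false × ∃[ f′ ] Inv f′ m′)
  exec-while {b} Inv done body f {m} inv with ⟦ b ⟧ m in e≡
  ... | false = halts (whileᶠ e≡) (s≤s z≤n) (e≡ , f , inv)
  exec-while Inv done body zero inv | true = ⊥-elim (done inv e≡)
  exec-while {d = d} Inv done body (suc f) inv | true
    with halts r c≤ inv′ ← body inv e≡
    with halts r′ c′≤ q ← exec-while Inv done body f inv′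
    = halts (whileᵗ e≡ r r′) (s≤s (≤-trans (+-mono-≤ c≤ c′≤) (≤-reflexive (+-suc d (f * suc d))))) q

  -- This and the next three rules replace register contents by known values, so that the resulting
  -- state has the form in which the invariants record it.
  move≡ : ∀ {m r s v} → reg m s ≡ v → w ⊢ m ⟶⟨ move r s ⟩ setReg r v m
  move≡ refl = move

  add≡ : ∀ {m r s t v} → reg m s + reg m t ≡ v → v < 2 ^ w → w ⊢ m ⟶⟨ add r s t ⟩ setReg r v m
  add≡ refl = add

  load≡ : ∀ {m r a s i} → reg m s ≡ i → w ⊢ m ⟶⟨ load r a s ⟩ setReg r (mem m a i) m
  load≡ refl = load

  store≡ : ∀ {m a s t i v} → reg m s ≡ i → reg m t ≡ v → w ⊢ m ⟶⟨ store a s t ⟩ setMem a i v m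
  store≡ refl refl = store

-- The program.

-- nil is never written and holds 0.
len idx ptr one nxt t₁ t₂ t₃ nil : Reg
len = 0
idx = 1
ptr = 2
one = 3
nxt = 4
t₁  = 5
t₂  = 6
t₃  = 7
nil = 8

text seeds borders covers reach : Arr
text    = 0
seeds   = 1
borders = 2
covers  = 3
reach   = 4

borderStep coverStep seedStep lseedProgram : Program

borderStep =
  exec (add nxt idx one) ⨾
  -- The letter with 0-based position k lies in cell k + 1; the same number is the length of the
  -- extended border.
  exec (add t₁ ptr one) ⨾
  exec (load t₂ text t₁) ⨾
  exec (load t₃ text nxt) ⨾
  cond (eq t₂ t₃)
    (exec (store borders nxt t₁) ⨾ exec (move idx nxt) ⨾ exec (move ptr t₁))
    (cond (eq ptr nil)
      (exec (store borders nxt nil) ⨾ exec (move idx nxt))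
      (exec (load ptr borders ptr)))

coverStep =
  exec (add nxt idx one) ⨾
  exec (load t₁ borders nxt) ⨾
  -- For an empty border this reads cell 0, which holds 0, as does cell 0 of `reach`; the test below
  -- then fails.
  exec (load t₂ covers t₁) ⨾
  exec (load t₃ reach t₂) ⨾
  exec (add t₃ t₃ t₂) ⨾
  cond (le nxt t₃)
    (exec (store covers nxt t₂) ⨾ exec (store reach t₂ nxt) ⨾ exec (move idx nxt))
    (exec (store covers nxt nxt) ⨾ exec (store reach nxt nxt) ⨾ exec (move idx nxt))

seedStep =
  exec (add nxt idx one) ⨾
  exec (load t₁ reach ptr) ⨾
  exec (load t₂ borders nxt) ⨾
  exec (add t₁ t₁ t₂) ⨾
  cond (le nxt t₁)
    (exec (store seeds nxt ptr) ⨾ exec (move idx nxt))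
    (exec (add ptr ptr one))

lseedProgram =
  exec (const one 1) ⨾
  -- The border of the prefix of length 1 is 0, the initial content of its cell.
  exec (const idx 1) ⨾
  while (lt idx len) borderStep ⨾
  exec (const idx 0) ⨾
  while (lt idx len) coverStep ⨾
  exec (const idx 0) ⨾
  -- A pointer at 0 always moves on, since R 0 = 0 and borders are proper.
  exec (const ptr 0) ⨾
  while (lt idx len) seedStep

-- At most 2n, n and 2n iterations, each of at most 9, 10 and 8 units, test included.
steps : ℕ → ℕ
steps n = suc (suc (suc ((n + n) * 9) + suc (suc (n * 10) + suc (suc (suc ((n + n) * 8))))))

-- Loop invariants and correctness of the program.

module Analysis {σ} (u : Word σ) {w : ℕ} (fits : ∀ {v} → v ≤ suc (length u + length u) → v < 2 ^ w) where

  open Prefixes (letter u)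

  n : ℕ
  n = length u

  fits-n : ∀ {v} → v ≤ n → v < 2 ^ w
  fits-n v≤n = fits (m≤n⇒m≤1+n (≤-trans v≤n (m≤m+n n n)))

  exit : ∀ m {i} → reg m idx ≡ i → reg m len ≡ n → ⟦ lt idx len ⟧ m ≡ false → n ≤ i
  exit _ idx≡ len≡ e≡ = subst₂ _≤_ len≡ idx≡ (≮⇒≥ (≡false⇒¬T e≡ ∘ <⇒<ᵇ))

  enter : ∀ m {i} → reg m idx ≡ i → reg m len ≡ n → ⟦ lt idx len ⟧ m ≡ true → i < n
  enter _ idx≡ len≡ e≡ = subst₂ _<_ idx≡ len≡ (<ᵇ⇒< _ _ (≡true⇒T e≡))

  suc≡ : ∀ m r {i} → reg m r ≡ i → reg m one ≡ 1 → reg m r + reg m one ≡ suc i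
  suc≡ _ _ {i} refl 1≡ rewrite 1≡ = +-comm i 1

  -- By `credit`, f is at least 2(n - i) + k, a potential that every branch lowers: a match raises
  -- both i and k by one, and a fallback lowers k. The field `covers₀` keeps the arrays of the
  -- second loop ready for it.
  record BorderInv (f : ℕ) (m : State) : Set where
    field
      {i k}   : ℕ
      len≡    : reg m len ≡ n
      idx≡    : reg m idx ≡ i
      ptr≡    : reg m ptr ≡ k
      one≡    : reg m one ≡ 1
      nil≡    : reg m nil ≡ 0
      text≡   : ∀ t → mem m text (suc t) ≡ letter u t
      failure : Failure (mem m borders) i k
      covers₀ : Reach (mem m covers) (mem m reach) 0
      credit  : n + n + k ≤ f + (i + i)

  borderInv-done : ∀ {m} → BorderInv 0 m → ⟦ lt idx len ⟧ m ≡ true → ⊥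
  borderInv-done {m} inv e≡ = <⇒≱ (+-mono-< i<n i<n) (≤-trans (m≤m+n (n + n) k) credit)
    where
    open BorderInv inv
    i<n = enter m idx≡ len≡ e≡

  borderInv-step : ∀ {f m} → BorderInv (suc f) m → ⟦ lt idx len ⟧ m ≡ true →
                   Exec w borderStep m 8 (BorderInv f)
  borderInv-step {f} {m} inv e≡ =
    exec-then (add≡ (suc≡ m idx idx≡ one≡) (fits-n i<n)) $
    exec-then (add≡ (suc≡ m ptr ptr≡ one≡) (fits-n k<n)) $
    exec-then (load≡ refl) $
    exec-then (load≡ refl) $
    exec-cond
      (λ same →
        exec-then (store≡ refl refl) $
        exec-then (move≡ refl) $
        exec-last (move≡ refl) record
          { len≡ = len≡ ; idx≡ = refl ; ptr≡ = refl ; one≡ = one≡ ; nil≡ = nil≡ ; text≡ = text≡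
          ; failure = failure-match failure (trans (sym (text≡ k)) (trans (≡ᵇ⇒≡ _ _ (≡true⇒T same)) (text≡ i)))
          ; covers₀ = covers₀
          ; credit  = ≤-trans (≤-reflexive (+-suc (n + n) k)) (≤-trans (s≤s credit) (≤-reflexive (sym (double f i))))
          })
      (λ differ →
        let x≢ = λ x≡ → ≡false⇒¬T differ (≡⇒≡ᵇ _ _ (trans (text≡ k) (trans x≡ (sym (text≡ i))))) in
        exec-cond
          (λ ptr=nil →
            let k≡0 = trans (sym ptr≡) (trans (≡ᵇ⇒≡ _ _ (≡true⇒T ptr=nil)) nil≡) in
            exec-then (store≡ refl nil≡) $
            exec-last (move≡ refl) record
              { len≡ = len≡ ; idx≡ = refl ; ptr≡ = trans ptr≡ k≡0 ; one≡ = one≡ ; nil≡ = nil≡ ; text≡ = text≡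
              ; failure = failure-none failure x≢ k≡0
              ; covers₀ = covers₀
              ; credit  = ≤-trans (+-monoʳ-≤ (n + n) z≤n)
                  (≤-trans credit (≤-trans (n≤1+n _) (≤-reflexive (sym (double f i)))))
              })
          (λ ptr≠nil →
            let F , Bk<k = failure-fallback failure x≢
                  (λ k≡0 → ≡false⇒¬T ptr≠nil (≡⇒≡ᵇ _ _ (trans ptr≡ (trans k≡0 (sym nil≡))))) in
            exec-last (load≡ ptr≡) record
              { len≡ = len≡ ; idx≡ = idx≡ ; ptr≡ = refl ; one≡ = one≡ ; nil≡ = nil≡ ; text≡ = text≡
              ; failure = F
              ; covers₀ = covers₀
              ; credit  = s≤s⁻¹ (<-≤-trans (+-monoʳ-< (n + n) Bk<k) credit)
              }))
    where
    open BorderInv inv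
    i<n = enter m idx≡ len≡ e≡
    k<n = <-trans (border-< (Failure.border failure)) i<n
    double : ∀ f i → f + (suc i + suc i) ≡ suc (suc f + (i + i))
    double = solve-∀

  record CoverInv (f : ℕ) (m : State) : Set where
    field
      {i}     : ℕ
      len≡    : reg m len ≡ n
      idx≡    : reg m idx ≡ i
      one≡    : reg m one ≡ 1
      i≤n     : i ≤ n
      longest : Table LongestBorder (mem m borders) n
      reached : Reach (mem m covers) (mem m reach) i
      credit  : n ≤ f + i

  coverInv-done : ∀ {m} → CoverInv 0 m → ⟦ lt idx len ⟧ m ≡ true → ⊥
  coverInv-done {m} inv e≡ = <⇒≱ (enter m idx≡ len≡ e≡) credit
    where open CoverInv inv

  coverInv-step : ∀ {f m} → CoverInv (suc f) m → ⟦ lt idx len ⟧ m ≡ true →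
                  Exec w coverStep m 9 (CoverInv f)
  coverInv-step {f} {m} inv e≡ =
    exec-then (add≡ (suc≡ m idx idx≡ one≡) (fits-n i<n)) $
    exec-then (load≡ refl) $
    exec-then (load≡ refl) $
    exec-then (load≡ refl) $
    exec-then (add≡ refl (fits (m≤n⇒m≤1+n (+-mono-≤ R≤n q≤n)))) $
    exec-cond
      (λ reaches →
        exec-then (store≡ refl refl) $
        exec-then (store≡ refl refl) $
        exec-last (move≡ refl) record
          { len≡ = len≡ ; idx≡ = refl ; one≡ = one≡ ; i≤n = i<n ; longest = longest
          ; reached = reach-update reached (extension reached (longest i i<n) (≤ᵇ⇒≤ _ _ (≡true⇒T reaches)))
          ; credit  = ≤-trans credit (≤-reflexive (sym (+-suc f i)))
          })
      (λ fails →
        exec-then (store≡ refl refl) $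
        exec-then (store≡ refl refl) $
        exec-last (move≡ refl) record
          { len≡ = len≡ ; idx≡ = refl ; one≡ = one≡ ; i≤n = i<n ; longest = longest
          ; reached = reach-update reached (no-extension reached (longest i i<n) (≰⇒> (≡false⇒¬T fails ∘ ≤⇒≤ᵇ)))
          ; credit  = ≤-trans credit (≤-reflexive (sym (+-suc f i)))
          })
    where
    open CoverInv inv
    i<n = enter m idx≡ len≡ e≡
    b = mem m borders (suc i)
    q = mem m covers b

    R≤n : mem m reach q ≤ n
    R≤n = ≤-trans (Reach.R-≤ reached q) i≤n

    q≤n : q ≤ n
    q≤n = ≤-trans (reach-C-≤ reached (s≤s⁻¹ (border-< (proj₁ (longest i i<n))))) i≤n

  -- Each iteration raises i or ℓ by one, which is what `credit` counts. The field `least` concerns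
  -- the next prefix, whose entry is still being sought.
  record SeedInv (f : ℕ) (m : State) : Set where
    field
      {i ℓ}   : ℕ
      len≡    : reg m len ≡ n
      idx≡    : reg m idx ≡ i
      ptr≡    : reg m ptr ≡ ℓ
      one≡    : reg m one ≡ 1
      longest : Table LongestBorder (mem m borders) n
      reached : Reach (mem m covers) (mem m reach) n
      found   : Table (LeastSeed n) (mem m seeds) i
      least   : ∀ {s} → Seed n s (suc i) → ℓ ≤ s
      credit  : n + n ≤ f + (i + ℓ)

  seedInv-done : ∀ {m} → SeedInv 0 m → ⟦ lt idx len ⟧ m ≡ true → ⊥
  -- The next prefix is a seed of itself, so ℓ ≤ i + 1 ≤ n, and i + ℓ stays below 2n.
  seedInv-done {m} inv e≡ = <⇒≱ (+-mono-<-≤ i<n (≤-trans (least (seed-self i<n)) i<n)) credit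
    where
    open SeedInv inv
    i<n = enter m idx≡ len≡ e≡

  seedInv-step : ∀ {f m} → SeedInv (suc f) m → ⟦ lt idx len ⟧ m ≡ true →
                 Exec w seedStep m 7 (SeedInv f)
  seedInv-step {f} {m} inv e≡ =
    exec-then (add≡ (suc≡ m idx idx≡ one≡) (fits-n i<n)) $
    exec-then (load≡ ptr≡) $
    exec-then (load≡ refl) $
    exec-then (add≡ refl (fits (m≤n⇒m≤1+n (+-mono-≤ (Reach.R-≤ reached ℓ) b≤n)))) $
    exec-cond
      (λ reaches →
        exec-then (store≡ refl ptr≡) $
        exec-last (move≡ refl) record
          { len≡ = len≡ ; idx≡ = refl ; ptr≡ = ptr≡ ; one≡ = one≡ ; longest = longest ; reached = reached
          ; found  = table-suc (LeastSeed n) (mem m seeds) found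
              (pointer-stop (mem m borders) longest reached i<n least (≤ᵇ⇒≤ _ _ (≡true⇒T reaches)))
          ; least  = least-seed-suc i<n least
          ; credit = ≤-trans credit (≤-reflexive (sym (+-suc f (i + ℓ))))
          })
      (λ fails →
        exec-last (add≡ (suc≡ m ptr ptr≡ one≡) (fits (s≤s (≤-trans ℓ≤n (m≤m+n n n))))) record
          { len≡ = len≡ ; idx≡ = idx≡ ; ptr≡ = refl ; one≡ = one≡ ; longest = longest ; reached = reached
          ; found  = found
          ; least  = pointer-advance (mem m borders) longest reached i<n least (≰⇒> (≡false⇒¬T fails ∘ ≤⇒≤ᵇ))
          ; credit = ≤-trans credit (≤-reflexive (trans (sym (+-suc f (i + ℓ))) (cong (f +_) (sym (+-suc i ℓ)))))
          })
    where
    open SeedInv inv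
    i<n = enter m idx≡ len≡ e≡

    ℓ≤n : ℓ ≤ n
    ℓ≤n = ≤-trans (least (seed-self i<n)) i<n

    b≤n : mem m borders (suc i) ≤ n
    b≤n = ≤-trans (<⇒≤ (border-< (proj₁ (longest i i<n)))) i<n

  borderInv-start : BorderInv (n + n) (setReg idx 1 (setReg one 1 (input u)))
  borderInv-start = record
    { len≡ = refl ; idx≡ = refl ; ptr≡ = refl ; one≡ = refl ; nil≡ = refl ; text≡ = λ _ → refl
    ; failure = record
        { borders = λ { zero _ → border-zero , s≤s⁻¹ ∘ border-< ; (suc _) (s≤s ()) }
        ; border  = border-zero
        ; maximal = s≤s⁻¹ ∘ border-< ∘ border-init
        }
    ; covers₀ = record
        { C-zero = refl ; covers = λ _ () ; R-≤ = λ _ → z≤n ; R-cover = λ _ () ; R-latest = λ _ () }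
    ; credit  = +-monoʳ-≤ (n + n) z≤n
    }

  coverInv-start : ∀ {f m} → BorderInv f m → ⟦ lt idx len ⟧ m ≡ false → CoverInv n (setReg idx 0 m)
  coverInv-start {m = m} inv e≡ = record
    { len≡ = len≡ ; idx≡ = refl ; one≡ = one≡ ; i≤n = z≤n
    ; longest = λ j j<n → Failure.borders failure j (<-≤-trans j<n (exit m idx≡ len≡ e≡))
    ; reached = covers₀
    ; credit  = m≤m+n n 0
    }
    where open BorderInv inv

  seedInv-start : ∀ {f m} → CoverInv f m → ⟦ lt idx len ⟧ m ≡ false →
                  SeedInv (n + n) (setReg ptr 0 (setReg idx 0 m))
  seedInv-start {m = m} inv e≡ = record
    { len≡ = len≡ ; idx≡ = refl ; ptr≡ = refl ; one≡ = one≡ ; longest = longest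
    ; reached = subst (Reach _ _) (≤-antisym i≤n (exit m idx≡ len≡ e≡)) reached
    ; found   = λ _ ()
    ; least   = λ _ → z≤n
    ; credit  = m≤m+n (n + n) 0
    }
    where open CoverInv inv

  seedPhase : ∀ {f m} → SeedInv f m → Exec w (while (lt idx len) seedStep) m
                (suc (f * 8)) (λ m → Table (LeastSeed n) (output m) n)
  seedPhase {f} inv₀ with exec-while {b = lt idx len} {seedStep} {7} SeedInv seedInv-done seedInv-step f inv₀
  ... | halts {m} r c≤ (e≡ , _ , inv) =
    halts r c≤ λ j j<n → found j (<-≤-trans j<n (exit m idx≡ len≡ e≡))
    where open SeedInv inv

  coverPhase : ∀ {m} → CoverInv n m →
               Exec w (while (lt idx len) coverStep ⨾
                       exec (const idx 0) ⨾ exec (const ptr 0) ⨾ while (lt idx len) seedStep)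
                 m (suc (n * 10) + suc (suc (suc ((n + n) * 8)))) (λ m → Table (LeastSeed n) (output m) n)
  coverPhase inv₀ =
    exec-seq (exec-while {b = lt idx len} {coverStep} {9} CoverInv coverInv-done coverInv-step n inv₀)
    λ (e≡ , _ , inv) →
    exec-then (const (fits z≤n)) $
    exec-then (const (fits z≤n)) $
    seedPhase (seedInv-start inv e≡)

  lseedProgram-correct : Exec w lseedProgram (input u) (steps n) (λ m → Table (LeastSeed n) (output m) n)
  lseedProgram-correct =
    exec-then (const (fits (s≤s z≤n))) $
    exec-then (const (fits (s≤s z≤n))) $
    exec-seq (exec-while {b = lt idx len} {borderStep} {8} BorderInv borderInv-done borderInv-step
                (n + n) borderInv-start)
    λ (e≡ , _ , inv) →
    exec-then (const (fits z≤n)) $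
    coverPhase (coverInv-start inv e≡)

-- Word size and asymptotic bounds.

wordSize : ℕ → ℕ → ℕ
wordSize σ n = σ + (3 + ⌈log₂ n ⌉)

n<2^[1+⌈log₂n⌉] : ∀ n → n < 2 ^ suc ⌈log₂ n ⌉
n<2^[1+⌈log₂n⌉] n = ≰⇒> λ 2^≤n →
  <-irrefl refl (subst (_≤ ⌈log₂ n ⌉) (⌈log₂2^n⌉≡n (suc ⌈log₂ n ⌉)) (⌈log₂⌉-mono-≤ 2^≤n))

-- The bound 2n + 1 covers every number that the program forms: sums of two table entries are at
-- most 2n, counters and constants at most n + 1.
wordSize-fits : ∀ σ n {v} → v ≤ suc (n + n) → v < 2 ^ wordSize σ n
wordSize-fits σ n {v} v≤ = begin-strict
  v                                 ≤⟨ v≤ ⟩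
  suc (n + n)                       <⟨ ≤-reflexive (cong suc (sym (+-suc n n))) ⟩
  suc n + suc n                     ≤⟨ +-mono-≤ (n<2^[1+⌈log₂n⌉] n) (n<2^[1+⌈log₂n⌉] n) ⟩
  2 ^ L + 2 ^ L                     ≡⟨ cong (2 ^ L +_) (+-identityʳ (2 ^ L)) ⟨
  2 ^ suc L                         ≤⟨ ^-monoʳ-≤ 2 (≤-trans (n≤1+n (suc L)) (m≤n+m (suc (suc L)) σ)) ⟩
  2 ^ wordSize σ n                  ∎
  where
  open ≤-Reasoning
  L = suc ⌈log₂ n ⌉

n≤2^n : ∀ n → n ≤ 2 ^ n
n≤2^n zero    = z≤n
n≤2^n (suc n) = +-mono-≤ (m^n>0 2 n) (≤-trans (n≤2^n n) (m≤m+n (2 ^ n) 0))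

wordSize∈O : ∀ σ → wordSize σ ∈O (λ n → ⌈log₂ n ⌉)
-- From n = 2 on the logarithm is at least 1 and absorbs the constant σ + 3.
wordSize∈O σ = σ + 4 , 2 , λ n 2≤n → let open ≤-Reasoning; L = ⌈log₂ n ⌉ in begin
  σ + (3 + L)            ≡⟨ +-assoc σ 3 L ⟨
  σ + 3 + L              ≡⟨ cong (_+ L) (*-identityʳ (σ + 3)) ⟨
  (σ + 3) * 1 + L        ≤⟨ +-monoˡ-≤ L (*-monoʳ-≤ (σ + 3) (⌈log₂⌉-mono-≤ 2≤n)) ⟩
  (σ + 3) * L + L        ≡⟨ collect σ L ⟩
  (σ + 4) * L            ∎
  where
  collect : ∀ σ L → (σ + 3) * L + L ≡ (σ + 4) * L
  collect = solve-∀

steps∈O : steps ∈O (λ n → n)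
-- Here 44 = 9 + 9 + 10 + 8 + 8 counts the iterations, and the additive 8 is absorbed once n ≥ 1.
steps∈O = 52 , 1 , λ n 1≤n → let open ≤-Reasoning in begin
  steps n         ≡⟨ collect n 9 10 8 ⟩
  44 * n + 8 * 1  ≤⟨ +-monoʳ-≤ (44 * n) (*-monoʳ-≤ 8 1≤n) ⟩
  44 * n + 8 * n  ≡⟨ *-distribʳ-+ n 44 8 ⟨
  52 * n          ∎
  where
  collect : ∀ n a b c →
    suc (suc (suc ((n + n) * a) + suc (suc (n * b) + suc (suc (suc ((n + n) * c)))))) ≡
    (a + a + b + c + c) * n + 8
  collect = solve-∀

lseedProgram-computes : ∀ σ → Computes {σ} lseedProgram (wordSize σ) steps (λ u i ℓ → IsLseed (take i u) ℓ)
lseedProgram-computes σ u =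
  fits (m≤n⇒m≤1+n (m≤m+n n n)) ,
  ≤-trans (n≤2^n σ) (^-monoʳ-≤ 2 (m≤m+n σ (3 + ⌈log₂ n ⌉))) ,
  result (Analysis.lseedProgram-correct u {w} fits)
  where
  n = length u
  w = wordSize σ n

  fits : ∀ {v} → v ≤ suc (n + n) → v < 2 ^ w
  fits = wordSize-fits σ n

  result : Exec w lseedProgram (input u) (steps n) (λ m → Table (Prefixes.LeastSeed (letter u) n) (output m) n) →
           ∃[ m ] ∃[ c ] (w ⊢⟨ lseedProgram , input u ⟩⇓⟨ m , c ⟩) × c ≤ steps n
             × (∀ i → 1 ≤ i → i ≤ n → IsLseed (take i u) (output m i))
  result (halts {m} {c} r c≤ table) =
    m , c , r , c≤ , λ { (suc i) _ i<n → leastSeed⇒lseed u i<n (table i i<n) }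

theorem1 : ∀ (σ : ℕ) →
    ∃[ p ] ∃[ w ] ∃[ T ]
    w ∈O (λ n → ⌈log₂ n ⌉) × T ∈O (λ n → n)
    × Computes {σ} p w T (λ u i ℓ → IsLseed (take i u) ℓ)
theorem1 σ = lseedProgram , wordSize σ , steps , wordSize∈O σ , steps∈O , lseedProgram-computes σ
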